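{- Let $m,n\geq2$, $d\geq0$, and $j\geq1$. Then the number of Fibonacci polyominoes $P\in\mathcal F_{m,n}$ with $\operatorname{des}(P)=d$ and $\operatorname{lmin}(P)=j$ equals \[ R(m,d+1,j)\binom{n-2}{m-1}+R(m-1,d,j-1)\binom{n-2}{m-2}. \]
   Context: A Fibonacci polyomino is a (nonempty) polyomino, considered up to translation, that is column-convex (each column is a contiguous segment of unit cells) and such that, reading columns from left to right, the bottom cell of each column lies exactly one unit above the bottom cell of the preceding column. Equivalently, it is given by a sequence of column heights $(h_1,\dots,h_m)$, $m\ge 1$, with $h_i\ge 2$ for $1\le i\le m-1$ and $h_m\ge 1$; column $i$ consists of the cells in column position $i$ and rows $i,i+1,\dots,i+h_i-1$. The horizontal (resp. vertical) semiperimeter is half the number of horizontal (resp. vertical) unit edges on the boundary (edges belonging to exactly one cell). $\mathcal F_{m,n}$ is the set of Fibonacci polyominoes with horizontal semiperimeter $m$ (equivalently $m$ columns) and vertical semiperimeter $n$. For $P$ with column heights $(h_1,\ldots,h_m)$: $\operatorname{des}(P)=|\{i:1\le i<m,\ h_i>h_{i+1}\}|$; $\operatorname{lmin}(P)$ is the number of left-to-right minima, i.e. of columns $i$ such that $i=1$ or $h_i<\min\{h_1,\ldots,h_{i-1}\}$. For $\ell\ge1$, $R(\ell,k,j)$ is the number of Dyck paths of semilength $\ell$ (paths from $(0,0)$ to $(2\ell,0)$ with steps $U=(1,1)$, $D=(1,-1)$ never going below the horizontal axis) with exactly $k$ peaks (consecutive steps $UD$) and exactly $j$ returns (down steps ending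 on the axis). It is known that $R(\ell,k,j)=\frac{j}{\ell}\binom{\ell}{k}\binom{\ell-j-1}{k-j}$ for $1\le j\le k\le\ell$, $j<\ell$; $R(\ell,\ell,\ell)=1$; and $R(\ell,k,j)=0$ otherwise. Binomial coefficients $\binom ab$ with $a\ge0$ vanish if $b<0$ or $b>a$. -}

module Defs where

open import Data.Bool using (if_then_else_)
open import Data.Empty using (⊥)
open import Data.List using (List; []; _∷_; _++_; map; concatMap; filter; length; upTo)
open import Data.List.Membership.Propositional using (_∈_)
open import Data.List.Relation.Unary.Unique.Propositional using (Unique)
open import Data.Nat using (ℕ; zero; suc; _+_; _*_; _⊓_; _≤_; _≟_; _<?_)
open import Data.Product using (Σ-syntax; _×_; _,_)
open import Data.Product.Properties using (≡-dec)
open import Function.Bundles using (_⇔_)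
open import Relation.Binary.PropositionalEquality using (_≡_)
open import Relation.Nullary using (no; does)
open import Relation.Nullary.Decidable using (_×-dec_)
open import Relation.Unary using (Decidable)
import Data.List.Membership.DecPropositional as DecMembership

-- The set { x | P x } is finite with exactly N elements.
HasCardinality : {A : Set} → (A → Set) → ℕ → Set
HasCardinality {A} P N =
  Σ[ xs ∈ List A ] (Unique xs × (∀ x → (x ∈ xs) ⇔ P x) × length xs ≡ N)

-- A polyomino up to translation is represented by its column heights
-- (h₁, …, hₘ), listed from left to right.  All columns but the last have
-- height at least 2, so that consecutive columns share an edge.
IsFibonacci : List ℕ → Set
IsFibonacci []               = ⊥
IsFibonacci (h ∷ [])         = 1 ≤ h
IsFibonacci (h ∷ hs@(_ ∷ _)) = 2 ≤ h × IsFibonacci hs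

-- The unit square [x , x+1] × [y , y+1] is the cell (x , y).
Cell : Set
Cell = ℕ × ℕ

cellsFrom : ℕ → List ℕ → List Cell
cellsFrom i []       = []
cellsFrom i (h ∷ hs) = map (λ k → i , i + k) (upTo h) ++ cellsFrom (suc i) hs

-- Column i consists of the cells (i , i), …, (i , i + hᵢ - 1), i = 1, …, m.
cells : List ℕ → List Cell
cells = cellsFrom 1

-- A horizontal edge is named by its left endpoint, a vertical one by its
-- lower endpoint.
Edge : Set
Edge = ℕ × ℕ

horizontalEdges : Cell → List Edge
horizontalEdges (x , y) = (x , y) ∷ (x , suc y) ∷ []

verticalEdges : Cell → List Edge
verticalEdges (x , y) = (x , y) ∷ (suc x , y) ∷ []

open DecMembership (≡-dec _≟_ _≟_) using (_∈?_)

cellsContaining : (Cell → List Edge) → Edge → List Cell → List Cell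
cellsContaining edges e = filter (λ c → e ∈? edges c)

-- The edges belonging to exactly one cell.  For a duplicate-free list of cells
-- such an edge is listed exactly once by concatMap, so the result is
-- duplicate-free as well.
boundary : (Cell → List Edge) → List Cell → List Edge
boundary edges cs =
  filter (λ e → length (cellsContaining edges e cs) ≟ 1) (concatMap edges cs)

-- Semiperimeter s means exactly 2 s boundary edges; no rounding is involved.
HasHorizontalSemiperimeter : List ℕ → ℕ → Set
HasHorizontalSemiperimeter P s = length (boundary horizontalEdges (cells P)) ≡ 2 * s

HasVerticalSemiperimeter : List ℕ → ℕ → Set
HasVerticalSemiperimeter P s = length (boundary verticalEdges (cells P)) ≡ 2 * s

𝓕 : ℕ → ℕ → List ℕ → Set
𝓕 m n P = IsFibonacci P × HasHorizontalSemiperimeter P m × HasVerticalSemiperimeter P n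

des : List ℕ → ℕ
des []                = 0
des (h ∷ [])          = 0
des (h ∷ hs@(h′ ∷ _)) = (if does (h′ <? h) then 1 else 0) + des hs

-- lminBelow μ hs counts the left-to-right minima within hs when the columns
-- preceding hs have minimum height μ.
lminBelow : ℕ → List ℕ → ℕ
lminBelow μ []       = 0
lminBelow μ (h ∷ hs) = (if does (h <? μ) then 1 else 0) + lminBelow (μ ⊓ h) hs

lmin : List ℕ → ℕ
lmin []       = 0
lmin (h ∷ hs) = suc (lminBelow h hs)

data Step : Set where
  U D : Step

-- DyckFrom a w: the path w started at altitude a stays weakly above the axis
-- and ends on it.
DyckFrom : ℕ → List Step → Set
DyckFrom a       []      = a ≡ 0
DyckFrom a       (U ∷ w) = DyckFrom (suc a) w
DyckFrom zero    (D ∷ w) = ⊥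
DyckFrom (suc a) (D ∷ w) = DyckFrom a w

dyckFrom? : ∀ a → Decidable (DyckFrom a)
dyckFrom? a       []      = a ≟ 0
dyckFrom? a       (U ∷ w) = dyckFrom? (suc a) w
dyckFrom? zero    (D ∷ w) = no λ ()
dyckFrom? (suc a) (D ∷ w) = dyckFrom? a w

peaks : List Step → ℕ
peaks []          = 0
peaks (U ∷ [])    = 0
peaks (U ∷ U ∷ w) = peaks (U ∷ w)
peaks (U ∷ D ∷ w) = suc (peaks w)
peaks (D ∷ w)     = peaks w

-- The first argument is the starting altitude.  Only its values on paths
-- satisfying DyckFrom matter; the clause for (zero , D) is junk.
returnsFrom : ℕ → List Step → ℕ
returnsFrom a             []      = 0
returnsFrom a             (U ∷ w) = returnsFrom (suc a) w
returnsFrom zero          (D ∷ w) = 0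
returnsFrom (suc zero)    (D ∷ w) = suc (returnsFrom zero w)
returnsFrom (suc (suc a)) (D ∷ w) = returnsFrom (suc a) w

words : ℕ → List (List Step)
words zero    = [] ∷ []
words (suc n) = map (U ∷_) (words n) ++ map (D ∷_) (words n)

DyckWith : ℕ → ℕ → List Step → Set
DyckWith k j w = DyckFrom 0 w × peaks w ≡ k × returnsFrom 0 w ≡ j

dyckWith? : ∀ k j → Decidable (DyckWith k j)
dyckWith? k j w = dyckFrom? 0 w ×-dec (peaks w ≟ k) ×-dec (returnsFrom 0 w ≟ j)

-- The number of Dyck paths of semilength ℓ with k peaks and j returns.
R : ℕ → ℕ → ℕ → ℕ
R ℓ k j = length (filter (dyckWith? k j) (words (2 * ℓ)))

{-# OPTIONS --safe #-}
module Submission where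

-- The vertical semiperimeter of a polyomino with heights h₁, …, hₘ is h₁ plus the
-- sum of hᵢ₊₁ − hᵢ + 1 over the non-descents i.  Cutting a sequence of positive
-- heights at its left-to-right minima μ₁ > ⋯ > μⱼ gives j blocks; each block is its
-- minimum followed by an arbitrary, possibly empty, positive sequence translated
-- upwards.  Recursively, the sequence becomes an ordered forest whose j roots are
-- the minima, the edge above the i-th root having length μᵢ − μᵢ₊₁ ≥ 1 (μⱼ₊₁ = 0).
-- Its m edges have total length the semiperimeter, and it has des + 1 leaves, so
-- positive sequences of semiperimeter N correspond to pairs of a Dyck path counted
-- by R(m, des + 1, j) and a composition of N into m parts.  Lowering all columns
-- by 1 turns a Fibonacci polyomino into such a sequence, followed by a 0 if the
-- last column has height 1; this 0 is a descent and a left-to-right minimum.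

open import Data.List using (List; []; _∷_; _++_; _∷ʳ_; map; concatMap; filter; length; applyUpTo; cartesianProduct)
import Data.List.Membership.DecPropositional as DecMembership
open import Data.List.Membership.Propositional using (_∈_; _∉_)
open import Data.List.Membership.Propositional.Properties using (∈-map⁺; ∈-map⁻; ∈-++⁺ˡ; ∈-++⁺ʳ; ∈-++⁻; ∈-filter⁺; ∈-filter⁻; ∈-cartesianProduct⁺; ∈-cartesianProduct⁻)
open import Data.List.Properties using (length-map; length-++; filter-++; filter-none; filter-accept; filter-reject; concatMap-++; map-applyUpTo; map-injective; ∷ʳ-injectiveˡ; ∷-injectiveʳ)
open import Data.List.Relation.Unary.All using (All; []; _∷_)
import Data.List.Relation.Unary.All as All
import Data.List.Relation.Unary.All.Properties as All
open import Data.List.Relation.Unary.AllPairs using ([]; _∷_)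
open import Data.List.Relation.Unary.Any using (here; there)
open import Data.List.Relation.Unary.Linked using (Linked; []; [-]; _∷_)
open import Data.List.Relation.Unary.Unique.Propositional using (Unique)
import Data.List.Relation.Unary.Unique.Propositional.Properties as Unique
open import Data.Nat using (ℕ; zero; suc; pred; _+_; _*_; _∸_; _⊔_; _⊓_; _≤_; _<_; _≥_; _≟_; _<?_; z≤n; s≤s)
open import Data.Nat.Combinatorics using (_C_; nCn≡1; nCk≡nC[n∸k]; nCk+nC[k+1]≡[n+1]C[k+1]; k>n⇒nCk≡0)
open import Data.Nat.ListAction using (sum)
open import Data.Nat.Properties
open import Data.Nat.Tactic.RingSolver using (solve-∀)
open import Data.Product using (Σ-syntax; ∃₂; _×_; _,_; proj₁; proj₂)
open import Data.Product.Properties using (≡-dec; ,-injectiveˡ; ,-injectiveʳ)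
open import Data.Sum using (_⊎_; inj₁; inj₂; [_,_]; [_,_]′)
open import Data.Sum.Properties using (inj₁-injective; inj₂-injective)
open import Function using (_∘_; id)
open import Function.Bundles using (mk⇔; Equivalence)
open import Relation.Binary.PropositionalEquality using (_≡_; _≢_; refl; sym; trans; cong; cong₂; subst; module ≡-Reasoning)
open import Relation.Nullary using (¬_; yes; no; contradiction)
open import Relation.Nullary.Decidable using (dec-true; dec-false)
open import Defs

-- Cardinalities

-- Injectivity is asked only on `Q`, because `decode` separates codes only among valid pairs of a
-- path and its labels.
Unique-map : {A B : Set} {Q : B → Set} (f : B → A) →
  (∀ {y y′} → Q y → Q y′ → f y ≡ f y′ → y ≡ y′) →
  ∀ {ys} → All Q ys → Unique ys → Unique (map f ys)
Unique-map f inj [] [] = []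
Unique-map f inj (q ∷ qs) (y∉ys ∷ uys) =
  All.map⁺ (All.zipWith (λ (q′ , y≢y′) eq → y≢y′ (inj q q′ eq)) (qs , y∉ys))
  ∷ Unique-map f inj qs uys

card-bijection : {A B : Set} {P : A → Set} {Q : B → Set} {N : ℕ} (f : B → A) →
  (∀ y → Q y → P (f y)) →
  (∀ y y′ → Q y → Q y′ → f y ≡ f y′ → y ≡ y′) →
  (∀ x → P x → Σ[ y ∈ B ] (Q y × f y ≡ x)) →
  HasCardinality Q N → HasCardinality P N
card-bijection {P = P} {Q} f pres inj surj (ys , uys , mem , len) =
  map f ys
  , Unique-map f (inj _ _) (All.tabulate (λ {y} → Equivalence.to (mem y))) uys
  , (λ x → mk⇔ to from)
  , trans (length-map f ys) len
  where
  to : ∀ {x} → x ∈ map f ys → P x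
  to x∈ with y , y∈ , refl ← ∈-map⁻ f x∈ = pres y (Equivalence.to (mem y) y∈)
  from : ∀ {x} → P x → x ∈ map f ys
  from p with y , q , refl ← surj _ p = ∈-map⁺ f (Equivalence.from (mem y) q)

card-⊎ : {A B : Set} {P : A → Set} {Q : B → Set} {a b : ℕ} →
  HasCardinality P a → HasCardinality Q b → HasCardinality [ P , Q ] (a + b)
card-⊎ {P = P} {Q} (xs , uxs , memx , lenx) (ys , uys , memy , leny) =
  map inj₁ xs ++ map inj₂ ys
  , Unique.++⁺ (Unique.map⁺ inj₁-injective uxs) (Unique.map⁺ inj₂-injective uys) disjoint
  , (λ z → mk⇔ (to z) (from z))
  , trans (length-++ (map inj₁ xs))
      (cong₂ _+_ (trans (length-map inj₁ xs) lenx) (trans (length-map inj₂ ys) leny))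
  where
  disjoint : ∀ {z} → ¬ (z ∈ map inj₁ xs × z ∈ map inj₂ ys)
  disjoint (z∈₁ , z∈₂) with _ , _ , refl ← ∈-map⁻ inj₁ z∈₁ with ∈-map⁻ inj₂ z∈₂
  ... | _ , _ , ()
  to : ∀ z → z ∈ map inj₁ xs ++ map inj₂ ys → [ P , Q ] z
  to z z∈ with ∈-++⁻ (map inj₁ xs) z∈
  ... | inj₁ z∈₁ with x , x∈ , refl ← ∈-map⁻ inj₁ z∈₁ = Equivalence.to (memx x) x∈
  ... | inj₂ z∈₂ with y , y∈ , refl ← ∈-map⁻ inj₂ z∈₂ = Equivalence.to (memy y) y∈
  from : ∀ z → [ P , Q ] z → z ∈ map inj₁ xs ++ map inj₂ ys
  from (inj₁ x) p = ∈-++⁺ˡ (∈-map⁺ inj₁ (Equivalence.from (memx x) p))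
  from (inj₂ y) q = ∈-++⁺ʳ (map inj₁ xs) (∈-map⁺ inj₂ (Equivalence.from (memy y) q))

length-cartesianProduct : {A B : Set} (xs : List A) (ys : List B) →
  length (cartesianProduct xs ys) ≡ length xs * length ys
length-cartesianProduct []       ys = refl
length-cartesianProduct (x ∷ xs) ys = trans (length-++ (map (x ,_) ys))
  (cong₂ _+_ (length-map (x ,_) ys) (length-cartesianProduct xs ys))

card-× : {A B : Set} {P : A → Set} {Q : B → Set} {a b : ℕ} →
  HasCardinality P a → HasCardinality Q b →
  HasCardinality (λ (x , y) → P x × Q y) (a * b)
card-× (xs , uxs , memx , lenx) (ys , uys , memy , leny) =
  cartesianProduct xs ys
  , Unique.cartesianProduct⁺ uxs uys
  , (λ (x , y) → mk⇔
      (λ xy∈ → let x∈ , y∈ = ∈-cartesianProduct⁻ xs ys xy∈ in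
               Equivalence.to (memx x) x∈ , Equivalence.to (memy y) y∈)
      (λ (p , q) → ∈-cartesianProduct⁺ (Equivalence.from (memx x) p) (Equivalence.from (memy y) q)))
  , trans (length-cartesianProduct xs ys) (cong₂ _*_ lenx leny)

-- Enumerating Dyck paths and compositions

words-Unique : ∀ n → Unique (words n)
words-Unique zero    = [] ∷ []
words-Unique (suc n) = Unique.++⁺
  (Unique.map⁺ ∷-injectiveʳ (words-Unique n)) (Unique.map⁺ ∷-injectiveʳ (words-Unique n)) disjoint
  where
  disjoint : ∀ {w} → ¬ (w ∈ map (U ∷_) (words n) × w ∈ map (D ∷_) (words n))
  disjoint (w∈₁ , w∈₂) with _ , _ , refl ← ∈-map⁻ (U ∷_) w∈₁ with ∈-map⁻ (D ∷_) w∈₂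
  ... | _ , _ , ()

∈-words⁻ : ∀ n {w} → w ∈ words n → length w ≡ n
∈-words⁻ zero    (here refl) = refl
∈-words⁻ (suc n) w∈ with ∈-++⁻ (map (U ∷_) (words n)) w∈
... | inj₁ w∈₁ with _ , v∈ , refl ← ∈-map⁻ (U ∷_) w∈₁ = cong suc (∈-words⁻ n v∈)
... | inj₂ w∈₂ with _ , v∈ , refl ← ∈-map⁻ (D ∷_) w∈₂ = cong suc (∈-words⁻ n v∈)

∈-words⁺ : ∀ w → w ∈ words (length w)
∈-words⁺ []      = here refl
∈-words⁺ (U ∷ w) = ∈-++⁺ˡ (∈-map⁺ (U ∷_) (∈-words⁺ w))
∈-words⁺ (D ∷ w) = ∈-++⁺ʳ (map (U ∷_) (words (length w))) (∈-map⁺ (D ∷_) (∈-words⁺ w))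

card-Dyck : ∀ ℓ k j → HasCardinality (λ w → length w ≡ 2 * ℓ × DyckWith k j w) (R ℓ k j)
card-Dyck ℓ k j =
  filter (dyckWith? k j) (words (2 * ℓ))
  , Unique.filter⁺ (dyckWith? k j) (words-Unique (2 * ℓ))
  , (λ w → mk⇔
      (λ w∈ → let w∈words , dyck = ∈-filter⁻ (dyckWith? k j) {xs = words (2 * ℓ)} w∈ in
              ∈-words⁻ (2 * ℓ) w∈words , dyck)
      (λ (len , dyck) → ∈-filter⁺ (dyckWith? k j) (subst (λ n → w ∈ words n) len (∈-words⁺ w)) dyck))
  , refl

-- A part of the composition is one more than the corresponding entry of cs.
Composition : ℕ → ℕ → List ℕ → Set
Composition m N cs = length cs ≡ m × sum cs + m ≡ N

increaseHead : List ℕ → List ℕ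
increaseHead []       = []
increaseHead (c ∷ cs) = suc c ∷ cs

-- Pascal's rule: a first part equal to 1, stored as entry 0, can be deleted; a larger first part
-- can be decreased by 1.
card-Composition : ∀ m N → HasCardinality (Composition (suc m) (suc N)) (N C m)
card-Composition zero N =
  (N ∷ []) ∷ []
  , [] ∷ []
  , (λ cs → mk⇔ to from)
  , sym (trans (nCk≡nC[n∸k] {0} {N} z≤n) (nCn≡1 N))
  where
  to : ∀ {cs} → cs ∈ (N ∷ []) ∷ [] → Composition 1 (suc N) cs
  to (here refl) = refl , trans (+-comm (N + 0) 1) (cong suc (+-identityʳ N))
  from : ∀ {cs} → Composition 1 (suc N) cs → cs ∈ (N ∷ []) ∷ []
  from {c ∷ []} (refl , eq) = here (cong (_∷ [])
    (trans (sym (+-identityʳ c)) (suc-injective (trans (+-comm 1 (c + 0)) eq))))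
card-Composition (suc m) zero =
  [] , [] , (λ cs → mk⇔ (λ ()) (from cs)) , sym (k>n⇒nCk≡0 {0} {suc m} (s≤s z≤n))
  where
  from : ∀ cs → Composition (suc (suc m)) 1 cs → cs ∈ []
  from cs (_ , eq) with () ← trans (sym (cong suc (+-suc (sum cs) m))) (trans (sym (+-suc (sum cs) (suc m))) eq)
card-Composition (suc m) (suc N) =
  subst (HasCardinality _) (nCk+nC[k+1]≡[n+1]C[k+1] N m)
    (card-bijection [ 0 ∷_ , increaseHead ] pres inj surj
      (card-⊎ (card-Composition m N) (card-Composition (suc m) N)))
  where
  Source : List ℕ ⊎ List ℕ → Set
  Source = [ Composition (suc m) (suc N) , Composition (suc (suc m)) (suc N) ]
  pres : ∀ y → Source y → Composition (suc (suc m)) (suc (suc N)) ([ 0 ∷_ , increaseHead ] y)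
  pres (inj₁ cs) (len , eq) = cong suc len , trans (+-suc (sum cs) (suc m)) (cong suc eq)
  pres (inj₂ (c ∷ cs)) (len , eq) = len , cong suc eq
  inj : ∀ y y′ → Source y → Source y′ →
        [ 0 ∷_ , increaseHead ] y ≡ [ 0 ∷_ , increaseHead ] y′ → y ≡ y′
  inj (inj₁ _)       (inj₁ _)       _ _ refl = refl
  inj (inj₁ _)       (inj₂ (_ ∷ _)) _ _ ()
  inj (inj₂ (_ ∷ _)) (inj₁ _)       _ _ ()
  inj (inj₂ (_ ∷ _)) (inj₂ (_ ∷ _)) _ _ refl = refl
  inj (inj₁ _)       (inj₂ [])      _ (() , _) _
  inj (inj₂ [])      (_)            (() , _) _ _
  inj (inj₂ (_ ∷ _)) (inj₂ [])      _ (() , _) _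
  surj : ∀ cs → Composition (suc (suc m)) (suc (suc N)) cs →
         Σ[ y ∈ List ℕ ⊎ List ℕ ] (Source y × [ 0 ∷_ , increaseHead ] y ≡ cs)
  surj (zero ∷ cs)  (len , eq) =
    inj₁ cs , (suc-injective len , suc-injective (trans (sym (+-suc (sum cs) (suc m))) eq)) , refl
  surj (suc c ∷ cs) (len , eq) = inj₂ (c ∷ cs) , (len , suc-injective eq) , refl

-- Coding positive sequences by labelled Dyck paths

first : List ℕ → ℕ
first []      = 0
first (x ∷ _) = x

-- The maximum selects the right case by itself: the next column is pushed when it reaches
-- `first st`, and otherwise it is at most `pred (first st)`. Since `first [] = 0`, a root drops to
-- the next minimum, and the last root to 0.
level : List ℕ → List ℕ → ℕ
level hs st = first hs ⊔ pred (first st)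

-- st is the stack of the columns read before hs whose step D is still to come,
-- top first: reading h pops the columns higher than h, then pushes h.  One plus
-- the label of a popped μ is its drop to h when h is pushed next, and otherwise
-- its drop to one below the new top; level is this reference height.
data Codes : (hs st : List ℕ) → List Step → List ℕ → Set where
  done : Codes [] [] [] []
  pop  : ∀ {hs st μ w c cs} → μ ≡ suc (c + level hs st) →
         Codes hs st w cs → Codes hs (μ ∷ st) (D ∷ w) (c ∷ cs)
  push : ∀ {h hs st w cs} → first st ≤ h →
         Codes hs (h ∷ st) w cs → Codes (h ∷ hs) st (U ∷ w) cs

pop-first≤ : ∀ {μ} c hs st → μ ≡ suc (c + level hs st) → first st ≤ μ
pop-first≤ c hs st refl = ≤-trans (pred≤⇒≤suc (first st) (m≤n⊔m (first hs) _)) (s≤s (m≤n+m (level hs st) c))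
  where
  pred≤⇒≤suc : ∀ a {b} → pred a ≤ b → a ≤ suc b
  pred≤⇒≤suc zero    _  = z≤n
  pred≤⇒≤suc (suc a) le = s≤s le

-- Makes `pop` and `push` mutually exclusive, since `push` requires `first st ≤ h`. It also supplies
-- the strict inequality behind each descent and each new minimum.
pop-first< : ∀ {μ} c hs st → μ ≡ suc (c + level hs st) → first hs < μ
pop-first< c hs st refl = s≤s (≤-trans (m≤m⊔n (first hs) _) (m≤n+m (level hs st) c))

Linked-tail : ∀ {x : ℕ} {xs} → Linked _≥_ (x ∷ xs) → Linked _≥_ xs
Linked-tail [-]     = []
Linked-tail (_ ∷ l) = l

Linked-first≤ : ∀ {x : ℕ} {xs} → Linked _≥_ (x ∷ xs) → first xs ≤ x
Linked-first≤ [-]     = z≤n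
Linked-first≤ (p ∷ l) = p

Linked-cons : ∀ {x : ℕ} {xs} → first xs ≤ x → Linked _≥_ xs → Linked _≥_ (x ∷ xs)
Linked-cons _  []          = [-]
Linked-cons le l@[-]       = le ∷ l
Linked-cons le l@(_ ∷ _)   = le ∷ l

-- A code ends with an empty stack, so every entry of `st` is popped later, and each pop bounds the
-- entry below it. Sortedness is therefore a consequence and not a condition on codes.
Codes-Linked : ∀ {hs st w cs} → Codes hs st w cs → Linked _≥_ st
Codes-Linked done = []
Codes-Linked {hs} {_ ∷ st} {cs = c ∷ _} (pop eq p) = Linked-cons (pop-first≤ c hs st eq) (Codes-Linked p)
Codes-Linked (push _ p) = Linked-tail (Codes-Linked p)

-- Every column is pushed and later popped, and a popped height is a successor.
Codes-positive : ∀ {hs st w cs} → Codes hs st w cs → All (1 ≤_) hs × All (1 ≤_) st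
Codes-positive done = [] , []
Codes-positive (pop refl p) = let a , b = Codes-positive p in a , s≤s z≤n ∷ b
Codes-positive (push _ p) with a , b ∷ bs ← Codes-positive p = b ∷ a , bs

-- Works from the right end of the word, where both lists are empty: `D` restores a stack entry from
-- its label, and `U` returns the top of the stack to the unread columns. Missing labels and an
-- empty stack at `U` get junk values.
decode : List Step → List ℕ → List ℕ × List ℕ
decode []      cs       = [] , []
decode (D ∷ w) []       = [] , []
decode (D ∷ w) (c ∷ cs) = let hs , st = decode w cs in hs , suc (c + level hs st) ∷ st
decode (U ∷ w) cs with decode w cs
... | hs , []     = [] , []
... | hs , h ∷ st = h ∷ hs , st

Codes⇒decode : ∀ {hs st w cs} → Codes hs st w cs → decode w cs ≡ (hs , st)
Codes⇒decode done         = refl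
Codes⇒decode (pop refl p) rewrite Codes⇒decode p = refl
Codes⇒decode (push _ p)   rewrite Codes⇒decode p = refl

-- The equation on lengths provides one label for each `D`: a path from altitude `a` down to the
-- axis has `a` more steps `D` than `U`.
Codes-total-word : ∀ a w cs → DyckFrom a w → a + length w ≡ 2 * length cs →
  ∃₂ λ hs st → length st ≡ a × Codes hs st w cs
Codes-total-word a [] [] refl eq = [] , [] , refl , done
Codes-total-word a [] (c ∷ cs) refl ()
Codes-total-word a (U ∷ w) cs dyck eq
  with Codes-total-word (suc a) w cs dyck (trans (sym (+-suc a (length w))) eq)
-- The side condition of `push` holds automatically, as the stack of any code is sorted.
... | hs , h ∷ st , len , p = h ∷ hs , st , suc-injective len , push (Linked-first≤ (Codes-Linked p)) p
Codes-total-word (suc a) (D ∷ w) (c ∷ cs) dyck eq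
  with hs , st , len , p ← Codes-total-word a w cs dyck
    (suc-injective (suc-injective (trans (sym (cong suc (+-suc a (length w)))) (trans eq (*-suc 2 (length cs))))))
  = hs , suc (c + level hs st) ∷ st , cong suc len , pop refl p

pop-label : ∀ {μ} hs st → 1 ≤ μ → first hs < μ → first st ≤ μ →
  μ ≡ suc ((pred μ ∸ level hs st) + level hs st)
pop-label {suc μ} hs st _ (s≤s lt) le = cong suc (sym (m∸n+n≡m (⊔-lub lt (pred-mono-≤ le))))

-- The stack algorithm: pop while the top exceeds the next column, then push. The recursion is
-- lexicographic, since the stack grows only when `hs` shrinks.
Codes-total-heights : ∀ hs st → All (1 ≤_) hs → All (1 ≤_) st → Linked _≥_ st →
  ∃₂ λ w cs → Codes hs st w cs
Codes-total-heights [] [] _ _ _ = [] , [] , done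
Codes-total-heights [] (μ ∷ st) _ (q ∷ qs) l =
  let w , cs , p = Codes-total-heights [] st [] qs (Linked-tail l)
  in D ∷ w , _ , pop (pop-label [] st q q (Linked-first≤ l)) p
Codes-total-heights (h ∷ hs) [] (r ∷ rs) _ _ =
  let w , cs , p = Codes-total-heights hs (h ∷ []) rs (r ∷ []) [-]
  in U ∷ w , cs , push z≤n p
Codes-total-heights (h ∷ hs) (μ ∷ st) (r ∷ rs) (q ∷ qs) l =
  [ (λ h<μ →
      let w , cs , p = Codes-total-heights (h ∷ hs) st (r ∷ rs) qs (Linked-tail l)
      in D ∷ w , _ , pop (pop-label (h ∷ hs) st q h<μ (Linked-first≤ l)) p)
  , (λ μ≤h →
      let w , cs , p = Codes-total-heights hs (h ∷ μ ∷ st) rs (r ∷ q ∷ qs) (μ≤h ∷ l)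
      in U ∷ w , cs , push μ≤h p)
  ]′ (<-≤-connex h μ)

-- Gives injectivity of decoding: comparing the top of the stack with the next column forces the
-- step, and a popped height forces its label.
Codes-deterministic : ∀ {hs st w cs w′ cs′} → Codes hs st w cs → Codes hs st w′ cs′ →
  w ≡ w′ × cs ≡ cs′
Codes-deterministic done done = refl , refl
Codes-deterministic {hs} {μ ∷ st} {cs = c ∷ _} {cs′ = c′ ∷ _} (pop eq p) (pop eq′ p′)
  with refl , refl ← Codes-deterministic p p′
  with refl ← +-cancelʳ-≡ (level hs st) c c′ (suc-injective (trans (sym eq) eq′)) = refl , refl
Codes-deterministic (push _ p) (push _ p′)
  with refl , refl ← Codes-deterministic p p′ = refl , refl
Codes-deterministic {hs} {μ ∷ st} {cs = c ∷ _} (pop eq p) (push le p′) =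
  contradiction le (<⇒≱ (pop-first< c hs st eq))
Codes-deterministic {hs} {μ ∷ st} {cs′ = c ∷ _} (push le p) (pop eq p′) =
  contradiction le (<⇒≱ (pop-first< c hs st eq))

-- Statistics of a sequence read off its code

Codes-Dyck : ∀ {hs st w cs} → Codes hs st w cs → DyckFrom (length st) w
Codes-Dyck done       = refl
Codes-Dyck (pop _ p)  = Codes-Dyck p
Codes-Dyck (push _ p) = Codes-Dyck p

Codes-length-labels : ∀ {hs st w cs} → Codes hs st w cs → length cs ≡ length hs + length st
Codes-length-labels done = refl
Codes-length-labels {hs} (pop _ p)  = trans (cong suc (Codes-length-labels p)) (sym (+-suc (length hs) _))
Codes-length-labels {h ∷ hs} (push _ p) = trans (Codes-length-labels p) (+-suc (length hs) _)

Codes-length-word : ∀ {hs st w cs} → Codes hs st w cs → length w ≡ 2 * length hs + length st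
Codes-length-word done = refl
Codes-length-word {hs} (pop _ p)  = trans (cong suc (Codes-length-word p)) (sym (+-suc (2 * length hs) _))
Codes-length-word {h ∷ hs} {st} (push _ p) = trans (cong suc (Codes-length-word p)) (lemma (length hs) (length st))
  where
  lemma : ∀ a b → suc (2 * a + suc b) ≡ 2 * suc a + b
  lemma = solve-∀

-- A non-descent contributes h′ − h + 1; the truncated difference of a descent is 0.
rise : List ℕ → ℕ
rise []                = 0
rise (h ∷ [])          = 0
rise (h ∷ hs@(h′ ∷ _)) = (suc h′ ∸ h) + rise hs

-- The vertical semiperimeter when all heights are positive, as `verticalBoundary-length` shows.
ascent : List ℕ → ℕ
ascent hs = first hs + rise hs

+∸-⊔ : ∀ m n → m + (n ∸ m) ≡ n ⊔ m
+∸-⊔ zero    n       = sym (⊔-identityʳ n)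
+∸-⊔ (suc m) zero    = cong suc (+-identityʳ m)
+∸-⊔ (suc m) (suc n) = cong suc (+∸-⊔ m n)

-- An invariant for every intermediate stack; for the empty stack the right side is `ascent hs`. A
-- pop lowers `level` by `c` and the stack length by 1, together the part `suc c`. A push changes
-- nothing: the stack gains one unit, and one more than the new level is the larger of
-- `suc (first hs)` and `h`, which is `h` plus the contribution of this column to `rise`.
Codes-sum : ∀ {hs st w cs} → Codes hs st w cs →
  sum cs + length cs ≡ level hs st + rise hs + length st
Codes-sum done = refl
Codes-sum {hs} {_ ∷ st} {_} {c ∷ cs} (pop refl p) = begin
  c + sum cs + suc (length cs)                       ≡⟨ lemma₁ c (sum cs) (length cs) ⟩
  suc (c + (sum cs + length cs))                     ≡⟨ cong (λ z → suc (c + z)) (Codes-sum p) ⟩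
  suc (c + (level hs st + rise hs + length st))      ≡⟨ lemma₂ c (level hs st) (rise hs) (length st) ⟩
  (c + level hs st) + rise hs + suc (length st)      ≡⟨ cong (λ z → z + rise hs + suc (length st)) (sym (m≤n⇒m⊔n≡n (≤-trans (m≤m⊔n (first hs) _) (m≤n+m (level hs st) c)))) ⟩
  (first hs ⊔ (c + level hs st)) + rise hs + suc (length st) ∎
  where
  open ≡-Reasoning
  lemma₁ : ∀ a b d → a + b + suc d ≡ suc (a + (b + d))
  lemma₁ = solve-∀
  lemma₂ : ∀ a b d e → suc (a + (b + d + e)) ≡ (a + b) + d + suc e
  lemma₂ = solve-∀
Codes-sum {h ∷ hs} {st} {_} {cs} (push {h = h} le p) = begin
  sum cs + length cs                              ≡⟨ Codes-sum p ⟩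
  level hs (h ∷ st) + rise hs + suc (length st)   ≡⟨ +-suc _ (length st) ⟩
  suc (level hs (h ∷ st) + rise hs) + length st   ≡⟨ cong (_+ length st) (level-push hs (All.head (proj₂ (Codes-positive p)))) ⟩
  h + rise (h ∷ hs) + length st                   ≡⟨ cong (λ z → z + rise (h ∷ hs) + length st) (sym (m≥n⇒m⊔n≡m (≤-trans pred[n]≤n le))) ⟩
  level (h ∷ hs) st + rise (h ∷ hs) + length st   ∎
  where
  open ≡-Reasoning
  level-push : ∀ {h} hs → 1 ≤ h → suc (level hs (h ∷ st) + rise hs) ≡ h + rise (h ∷ hs)
  level-push {suc h} []        _ = refl
  level-push {suc h} (h′ ∷ hs) _ = cong suc
    (trans (cong (_+ rise (h′ ∷ hs)) (sym (+∸-⊔ h h′))) (+-assoc h (h′ ∸ h) _))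

des-< : ∀ {h h′} hs → h′ < h → des (h ∷ h′ ∷ hs) ≡ suc (des (h′ ∷ hs))
des-< {h} {h′} hs h′<h rewrite dec-true (h′ <? h) h′<h = refl

des-≥ : ∀ {h h′} hs → h ≤ h′ → des (h ∷ h′ ∷ hs) ≡ des (h′ ∷ hs)
des-≥ {h} {h′} hs h≤h′ rewrite dec-false (h′ <? h) (≤⇒≯ h≤h′) = refl

-- The number of maximal weakly increasing runs. The value 0 at the empty list is what `Codes-peaks`
-- needs when only pops remain.
runs : List ℕ → ℕ
runs []         = 0
runs hs@(_ ∷ _) = suc (des hs)

-- A peak is a push followed at once by a pop, so its column either is the last one or precedes a
-- lower one.
Codes-peaks : ∀ {hs st w cs} → Codes hs st w cs → peaks w ≡ runs hs
Codes-peaks done      = refl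
Codes-peaks (pop _ p) = Codes-peaks p
Codes-peaks {_ ∷ []} (push _ (pop _ p)) = cong suc (Codes-peaks p)
Codes-peaks {_ ∷ h′ ∷ hs} {st} {cs = c ∷ _} (push _ (pop eq p)) =
  cong suc (trans (Codes-peaks p) (sym (des-< hs (pop-first< c (h′ ∷ hs) st eq))))
Codes-peaks {_ ∷ h′ ∷ hs} (push _ q@(push le _)) =
  trans (Codes-peaks q) (cong suc (sym (des-≥ hs le)))

lminBelow-< : ∀ {μ h} hs → h < μ → lminBelow μ (h ∷ hs) ≡ suc (lminBelow h hs)
lminBelow-< {μ} {h} hs h<μ
  rewrite dec-true (h <? μ) h<μ | m≥n⇒m⊓n≡n (<⇒≤ h<μ) = refl

lminBelow-≥ : ∀ {μ h} hs → μ ≤ h → lminBelow μ (h ∷ hs) ≡ lminBelow μ hs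
lminBelow-≥ {μ} {h} hs μ≤h
  rewrite dec-false (h <? μ) (≤⇒≯ μ≤h) | m≤n⇒m⊓n≡m μ≤h = refl

bottom : ℕ → List ℕ → ℕ
bottom μ []       = μ
bottom _ (μ ∷ st) = bottom μ st

bottom≤ : ∀ {μ st} → Linked _≥_ (μ ∷ st) → bottom μ st ≤ μ
bottom≤ [-]     = ≤-refl
bottom≤ (p ∷ l) = ≤-trans (bottom≤ l) p

-- Extends `lmin` to a partly read sequence: the bottom of the stack is the minimum of the columns
-- read so far. Its return is still to come, and every later record below it adds another.
minima : List ℕ → List ℕ → ℕ
minima hs []       = lmin hs
minima hs (μ ∷ st) = suc (lminBelow (bottom μ st) hs)

-- The D step reaching the axis pops the current minimum from the stack.
Codes-returns : ∀ {hs st w cs} → Codes hs st w cs →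
  returnsFrom (length st) w ≡ minima hs st
Codes-returns done = refl
Codes-returns {[]}     {_ ∷ []} (pop _ p) = cong suc (Codes-returns p)
Codes-returns {h ∷ hs} {_ ∷ []} {cs = c ∷ _} (pop eq p) =
  cong suc (trans (Codes-returns p) (sym (lminBelow-< hs (pop-first< c (h ∷ hs) [] eq))))
Codes-returns {_} {_ ∷ _ ∷ _} (pop _ p) = Codes-returns p
Codes-returns {_} {[]} (push _ p) = Codes-returns p
Codes-returns {h ∷ hs} {μ ∷ st} (push le p) = trans (Codes-returns p)
  (cong suc (sym (lminBelow-≥ hs (≤-trans (bottom≤ (Linked-tail (Codes-Linked p))) le))))

PositiveSequence : ℕ → ℕ → ℕ → ℕ → List ℕ → Set
PositiveSequence m N k j hs =
  All (1 ≤_) hs × length hs ≡ m × ascent hs ≡ N × runs hs ≡ k × lmin hs ≡ j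

-- `decode` is the bijection: `Codes-total-word` makes it land in codes, `Codes-deterministic` makes
-- it injective and `Codes-total-heights` makes it surjective.
card-PositiveSequence : ∀ m N k j →
  HasCardinality (PositiveSequence (suc m) (suc N) k j) (R (suc m) k j * (N C m))
card-PositiveSequence m N k j =
  card-bijection f pres inj surj (card-× (card-Dyck (suc m) k j) (card-Composition m N))
  where
  Source : List Step × List ℕ → Set
  Source (w , cs) = (length w ≡ 2 * suc m × DyckWith k j w) × Composition (suc m) (suc N) cs
  f : List Step × List ℕ → List ℕ
  f (w , cs) = proj₁ (decode w cs)
  codes : ∀ y → Source y → Codes (f y) [] (proj₁ y) (proj₂ y)
  codes (w , cs) ((len , dyck , _) , (len′ , _))
    with Codes-total-word 0 w cs dyck (trans len (cong (2 *_) (sym len′)))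
  ... | hs , [] , _ , p = subst (λ z → Codes (proj₁ z) [] w cs) (sym (Codes⇒decode p)) p
  stats : ∀ {hs w cs} → Codes hs [] w cs → length cs ≡ length hs × sum cs + length cs ≡ ascent hs
  stats {hs} p = trans (Codes-length-labels p) (+-identityʳ _)
    , trans (Codes-sum p) (trans (+-identityʳ _) (cong (_+ rise hs) (⊔-identityʳ (first hs))))
  pres : ∀ y → Source y → PositiveSequence (suc m) (suc N) k j (f y)
  pres (w , cs) s@((_ , _ , pk , rt) , (len′ , tot)) =
    let p = codes (w , cs) s ; len , asc = stats p in
    proj₁ (Codes-positive p) , trans (sym len) len′
    , trans (sym asc) (trans (cong (sum cs +_) len′) tot)
    , trans (sym (Codes-peaks p)) pk , trans (sym (Codes-returns p)) rt
  inj : ∀ y y′ → Source y → Source y′ → f y ≡ f y′ → y ≡ y′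
  inj (w , cs) (w′ , cs′) s s′ eq =
    let eq₁ , eq₂ = Codes-deterministic (codes _ s) (subst (λ hs → Codes hs [] w′ cs′) (sym eq) (codes _ s′))
    in cong₂ _,_ eq₁ eq₂
  surj : ∀ hs → PositiveSequence (suc m) (suc N) k j hs → Σ[ y ∈ List Step × List ℕ ] (Source y × f y ≡ hs)
  surj (hs) (pos , len , asc , pk , lm) =
    let w , cs , p = Codes-total-heights hs [] pos [] []
        len′ , asc′ = stats p
    in (w , cs)
       , ( ( trans (Codes-length-word p) (trans (+-identityʳ _) (cong (2 *_) len))
           , Codes-Dyck p , trans (Codes-peaks p) pk , trans (Codes-returns p) lm)
         , (trans len′ len , trans (cong (sum cs +_) (sym (trans len′ len))) (trans asc′ asc)))
       , cong proj₁ (Codes⇒decode p)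

-- Perimeters

open DecMembership (≡-dec _≟_ _≟_) using (_∈?_)

multiplicity : (Cell → List Edge) → Edge → List Cell → ℕ
multiplicity edges e cs = length (cellsContaining edges e cs)

module _ (edges : Cell → List Edge) {e : Edge} where

  multiplicity-++ : ∀ cs cs′ →
    multiplicity edges e (cs ++ cs′) ≡ multiplicity edges e cs + multiplicity edges e cs′
  multiplicity-++ cs cs′ =
    trans (cong length (filter-++ (λ c → e ∈? edges c) cs cs′)) (length-++ (cellsContaining edges e cs))

  multiplicity-∈ : ∀ {c} cs → e ∈ edges c → multiplicity edges e (c ∷ cs) ≡ suc (multiplicity edges e cs)
  multiplicity-∈ cs e∈c = cong length (filter-accept (λ c → e ∈? edges c) {xs = cs} e∈c)

  multiplicity-∉ : ∀ {c} cs → e ∉ edges c → multiplicity edges e (c ∷ cs) ≡ multiplicity edges e cs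
  multiplicity-∉ cs e∉c = cong length (filter-reject (λ c → e ∈? edges c) {xs = cs} e∉c)

  multiplicity-none : ∀ {cs} → All (λ c → e ∉ edges c) cs → multiplicity edges e cs ≡ 0
  multiplicity-none none = cong length (filter-none (λ c → e ∈? edges c) none)

-- The base row is a separate argument so that induction can remove the bottom cell.
column : ℕ → ℕ → ℕ → List Cell
column x b zero    = []
column x b (suc h) = (x , b) ∷ column x (suc b) h

applyUpTo-column : ∀ x b h (f : ℕ → Cell) → (∀ k → f k ≡ (x , b + k)) → applyUpTo f h ≡ column x b h
applyUpTo-column x b zero    f eq = refl
applyUpTo-column x b (suc h) f eq = cong₂ _∷_
  (trans (eq 0) (cong (x ,_) (+-identityʳ b)))
  (applyUpTo-column x (suc b) h (f ∘ suc) (λ k → trans (eq (suc k)) (cong (x ,_) (+-suc b k))))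

cellsFrom-∷ : ∀ i h hs → cellsFrom i (h ∷ hs) ≡ column i i h ++ cellsFrom (suc i) hs
cellsFrom-∷ i h hs = cong (_++ cellsFrom (suc i) hs)
  (trans (map-applyUpTo id (λ k → i , i + k) h) (applyUpTo-column i i h _ (λ _ → refl)))

All-column : {P : Cell → Set} → ∀ x b h → (∀ y → b ≤ y → y < b + h → P (x , y)) → All P (column x b h)
All-column x b zero    p = []
All-column x b (suc h) p = p b ≤-refl (m<m+n b (s≤s z≤n))
  ∷ All-column x (suc b) h (λ y b<y y< → p y (<⇒≤ b<y) (subst (y <_) (sym (+-suc b h)) y<))

All-cellsFrom : {P : Cell → Set} → ∀ i hs → (∀ x y → i ≤ x → P (x , y)) → All P (cellsFrom i hs)
All-cellsFrom         i []       p = []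
All-cellsFrom {P = P} i (h ∷ hs) p = subst (All P) (sym (cellsFrom-∷ i h hs))
  (All.++⁺ (All-column i i h (λ y _ _ → p i y ≤-refl))
           (All-cellsFrom (suc i) hs (λ x y i<x → p x y (<⇒≤ i<x))))

isOne : ℕ → ℕ
isOne 1 = 1
isOne _ = 0

-- `boundary` with the multiplicities detached from the list of cells: `N` stays that of the whole
-- polyomino while an induction removes columns from `cs`.
marked : (Edge → ℕ) → (Cell → List Edge) → List Cell → ℕ
marked N edges cs = length (filter (λ e → N e ≟ 1) (concatMap edges cs))

filter-isOne : ∀ (N : Edge → ℕ) e es →
  length (filter (λ e → N e ≟ 1) (e ∷ es)) ≡ isOne (N e) + length (filter (λ e → N e ≟ 1) es)
filter-isOne N e es with N e
... | zero        = refl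
... | suc zero    = refl
... | suc (suc _) = refl

marked-++ : ∀ N edges cs cs′ → marked N edges (cs ++ cs′) ≡ marked N edges cs + marked N edges cs′
marked-++ N edges cs cs′ = begin
  length (filter one? (concatMap edges (cs ++ cs′)))
    ≡⟨ cong (length ∘ filter one?) (concatMap-++ edges cs cs′) ⟩
  length (filter one? (concatMap edges cs ++ concatMap edges cs′))
    ≡⟨ cong length (filter-++ one? (concatMap edges cs) (concatMap edges cs′)) ⟩
  length (filter one? (concatMap edges cs) ++ filter one? (concatMap edges cs′))
    ≡⟨ length-++ (filter one? (concatMap edges cs)) ⟩
  marked N edges cs + marked N edges cs′ ∎
  where
  open ≡-Reasoning
  one? = λ e → N e ≟ 1

ones : (ℕ → ℕ) → ℕ → ℕ → ℕ
ones g b zero    = 0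
ones g b (suc h) = isOne (g b) + ones g (suc b) h

+-interchange : ∀ a b c d → a + (b + (c + d)) ≡ (a + c) + (b + d)
+-interchange = solve-∀

marked-vertical-column : ∀ N x b h → marked N verticalEdges (column x b h) ≡
  ones (λ y → N (x , y)) b h + ones (λ y → N (suc x , y)) b h
marked-vertical-column N x b zero    = refl
marked-vertical-column N x b (suc h) =
  trans (filter-isOne N (x , b) _)
    (trans (cong (isOne (N (x , b)) +_)
      (trans (filter-isOne N (suc x , b) _) (cong (isOne (N (suc x , b)) +_) (marked-vertical-column N x (suc b) h))))
    (+-interchange (isOne (N (x , b))) (isOne (N (suc x , b))) _ _))

marked-horizontal-column : ∀ N x b h → marked N horizontalEdges (column x b h) ≡
  ones (λ y → N (x , y)) b h + ones (λ y → N (x , y)) (suc b) h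
marked-horizontal-column N x b zero    = refl
marked-horizontal-column N x b (suc h) =
  trans (filter-isOne N (x , b) _)
    (trans (cong (isOne (N (x , b)) +_)
      (trans (filter-isOne N (x , suc b) _) (cong (isOne (N (x , suc b)) +_) (marked-horizontal-column N x (suc b) h))))
    (+-interchange (isOne (N (x , b))) (isOne (N (x , suc b))) _ _))

ones-none : ∀ g b h → (∀ y → b ≤ y → y < b + h → g y ≡ 2) → ones g b h ≡ 0
ones-none g b zero    two = refl
ones-none g b (suc h) two rewrite two b ≤-refl (m<m+n b (s≤s z≤n)) =
  ones-none g (suc b) h (λ y b<y y< → two y (<⇒≤ b<y) (subst (y <_) (sym (+-suc b h)) y<))

∉-horizontal : ∀ {x y x′ y′} → (x ≢ x′ ⊎ y ≢ y′ × y ≢ suc y′) → (x , y) ∉ horizontalEdges (x′ , y′)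
∉-horizontal (inj₁ x≢)       (here eq)         = x≢ (,-injectiveˡ eq)
∉-horizontal (inj₁ x≢)       (there (here eq)) = x≢ (,-injectiveˡ eq)
∉-horizontal (inj₂ (y≢ , _)) (here eq)         = y≢ (,-injectiveʳ eq)
∉-horizontal (inj₂ (_ , y≢)) (there (here eq)) = y≢ (,-injectiveʳ eq)

∉-vertical : ∀ {x y x′ y′} → (y ≢ y′ ⊎ x ≢ x′ × x ≢ suc x′) → (x , y) ∉ verticalEdges (x′ , y′)
∉-vertical (inj₁ y≢)       (here eq)         = y≢ (,-injectiveʳ eq)
∉-vertical (inj₁ y≢)       (there (here eq)) = y≢ (,-injectiveʳ eq)
∉-vertical (inj₂ (x≢ , _)) (here eq)         = x≢ (,-injectiveˡ eq)
∉-vertical (inj₂ (_ , x≢)) (there (here eq)) = x≢ (,-injectiveˡ eq)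

-- The horizontal perimeter

horizontal-below : ∀ x b h {y} → y < b → multiplicity horizontalEdges (x , y) (column x b h) ≡ 0
horizontal-below x b h y<b = multiplicity-none horizontalEdges (All-column x b h λ y′ b≤y′ _ →
  ∉-horizontal (inj₂ (<⇒≢ (<-≤-trans y<b b≤y′) , <⇒≢ (m<n⇒m<1+n (<-≤-trans y<b b≤y′)))))

horizontal-bottom : ∀ x b h → multiplicity horizontalEdges (x , b) (column x b (suc h)) ≡ 1
horizontal-bottom x b h = trans (multiplicity-∈ horizontalEdges {x , b} (column x (suc b) h) (here refl))
  (cong suc (horizontal-below x (suc b) h ≤-refl))

horizontal-inside : ∀ x b h y → b < y → y < b + h → multiplicity horizontalEdges (x , y) (column x b h) ≡ 2
horizontal-inside x b zero y b<y y< = contradiction (<-trans b<y y<) (<⇒≱ (s≤s (≤-reflexive (+-identityʳ b))))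
horizontal-inside x b (suc h) y b<y y< with y ≟ suc b
horizontal-inside x b (suc zero) _ _ y< | yes refl = contradiction y< (<⇒≱ (s≤s (≤-reflexive (+-comm b 1))))
horizontal-inside x b (suc (suc h)) _ _ _ | yes refl =
  trans (multiplicity-∈ horizontalEdges {x , suc b} (column x (suc b) (suc h)) (there (here refl)))
    (cong suc (horizontal-bottom x (suc b) h))
... | no y≢ = trans (multiplicity-∉ horizontalEdges {x , y} (column x (suc b) h) (∉-horizontal (inj₂ (>⇒≢ b<y , y≢))))
  (horizontal-inside x (suc b) h y (≤∧≢⇒< b<y (y≢ ∘ sym)) (subst (y <_) (+-suc b h) y<))

horizontal-top : ∀ x b h → multiplicity horizontalEdges (x , suc (b + h)) (column x b (suc h)) ≡ 1
horizontal-top x b zero rewrite +-identityʳ b =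
  multiplicity-∈ horizontalEdges {x , suc b} {x , b} [] (there (here refl))
horizontal-top x b (suc h) =
  trans (multiplicity-∉ horizontalEdges {x , suc (b + suc h)} (column x (suc b) (suc h))
          (∉-horizontal (inj₂ (>⇒≢ (s≤s (m≤m+n b _)) , >⇒≢ (s≤s (m<m+n b (s≤s z≤n)))))))
    (trans (cong (λ z → multiplicity horizontalEdges (x , suc z) (column x (suc b) (suc h))) (+-suc b h))
      (horizontal-top x (suc b) h))

ones-last : ∀ g b h → (∀ y → b ≤ y → y < b + h → g y ≡ 2) → g (b + h) ≡ 1 → ones g b (suc h) ≡ 1
ones-last g b zero    two one rewrite +-identityʳ b | one = refl
ones-last g b (suc h) two one rewrite two b ≤-refl (m<m+n b (s≤s z≤n)) =
  ones-last g (suc b) h (λ y b<y y< → two y (<⇒≤ b<y) (subst (y <_) (sym (+-suc b h)) y<))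
    (trans (cong g (sym (+-suc b h))) one)

-- Horizontal edges at abscissa `x` meet only cells of column `x`, so agreement of `N` from `i` on
-- survives the removal of a column. Each column contributes its bottom and its top edge; the edges
-- between have multiplicity 2.
marked-horizontal : ∀ N i hs → All (1 ≤_) hs →
  (∀ x y → i ≤ x → N (x , y) ≡ multiplicity horizontalEdges (x , y) (cellsFrom i hs)) →
  marked N horizontalEdges (cellsFrom i hs) ≡ 2 * length hs
marked-horizontal N i [] _ _ = refl
marked-horizontal N i (suc h ∷ hs) (_ ∷ pos) agree = begin
  marked N horizontalEdges (cellsFrom i (suc h ∷ hs))
    ≡⟨ cong (marked N horizontalEdges) (cellsFrom-∷ i (suc h) hs) ⟩
  marked N horizontalEdges (column i i (suc h) ++ cellsFrom (suc i) hs)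
    ≡⟨ marked-++ N horizontalEdges (column i i (suc h)) (cellsFrom (suc i) hs) ⟩
  marked N horizontalEdges (column i i (suc h)) + marked N horizontalEdges (cellsFrom (suc i) hs)
    ≡⟨ cong₂ _+_ (marked-horizontal-column N i i (suc h)) (marked-horizontal N (suc i) hs pos agree′) ⟩
  (ones g i (suc h) + ones g (suc i) (suc h)) + 2 * length hs
    ≡⟨ cong (_+ 2 * length hs) (cong₂ _+_ lower upper) ⟩
  2 + 2 * length hs
    ≡⟨ sym (*-suc 2 (length hs)) ⟩
  2 * suc (length hs) ∎
  where
  open ≡-Reasoning
  split : ∀ x y → i ≤ x → N (x , y) ≡ multiplicity horizontalEdges (x , y) (column i i (suc h))
                                      + multiplicity horizontalEdges (x , y) (cellsFrom (suc i) hs)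
  split x y i≤x = trans (agree x y i≤x)
    (trans (cong (multiplicity horizontalEdges (x , y)) (cellsFrom-∷ i (suc h) hs))
           (multiplicity-++ horizontalEdges (column i i (suc h)) (cellsFrom (suc i) hs)))
  agree′ : ∀ x y → suc i ≤ x → N (x , y) ≡ multiplicity horizontalEdges (x , y) (cellsFrom (suc i) hs)
  agree′ x y i<x = trans (split x y (<⇒≤ i<x))
    (cong (_+ _) (multiplicity-none horizontalEdges (All-column i i (suc h) λ _ _ _ → ∉-horizontal (inj₁ (>⇒≢ i<x)))))
  g : ℕ → ℕ
  g y = N (i , y)
  local : ∀ y → g y ≡ multiplicity horizontalEdges (i , y) (column i i (suc h))
  local y = trans (split i y ≤-refl) (trans (cong (_ +_)
    (multiplicity-none horizontalEdges (All-cellsFrom (suc i) hs λ _ _ i<x → ∉-horizontal (inj₁ (<⇒≢ i<x)))))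
    (+-identityʳ _))
  two : ∀ y → suc i ≤ y → y < suc i + h → g y ≡ 2
  two y i<y y< = trans (local y) (horizontal-inside i i (suc h) y i<y (subst (y <_) (sym (+-suc i h)) y<))
  -- Among the lower edges of the cells of a column only the first is on the boundary; among the
  -- upper edges, only the last.
  lower : ones g i (suc h) ≡ 1
  lower rewrite trans (local i) (horizontal-bottom i i h) = cong suc (ones-none g (suc i) h two)
  upper : ones g (suc i) (suc h) ≡ 1
  upper = ones-last g (suc i) h two (trans (local (suc i + h)) (horizontal-top i i h))

-- The vertical perimeter

vertical-outside : ∀ x x′ b h {y} → (y < b ⊎ b + h ≤ y) → multiplicity verticalEdges (x′ , y) (column x b h) ≡ 0
vertical-outside x x′ b h (inj₁ y<b) = multiplicity-none verticalEdges
  (All-column x b h λ _ b≤y′ _ → ∉-vertical (inj₁ (<⇒≢ (<-≤-trans y<b b≤y′))))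
vertical-outside x x′ b h (inj₂ top≤y) = multiplicity-none verticalEdges
  (All-column x b h λ _ _ y′< → ∉-vertical (inj₁ (>⇒≢ (<-≤-trans y′< top≤y))))

vertical-inside : ∀ x x′ b h {y} → (x′ ≡ x ⊎ x′ ≡ suc x) → b ≤ y → y < b + h →
  multiplicity verticalEdges (x′ , y) (column x b h) ≡ 1
vertical-inside x x′ b zero _ b≤y y< = contradiction (≤-<-trans b≤y y<) (<⇒≱ (s≤s (≤-reflexive (+-identityʳ b))))
vertical-inside x x′ b (suc h) {y} x′≡ b≤y y< with y ≟ b
... | yes refl = trans (multiplicity-∈ verticalEdges {x′ , y} (column x (suc b) h) (side x′≡))
    (cong suc (vertical-outside x x′ (suc b) h (inj₁ ≤-refl)))
  where
  side : (x′ ≡ x ⊎ x′ ≡ suc x) → (x′ , y) ∈ verticalEdges (x , y)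
  side (inj₁ refl) = here refl
  side (inj₂ refl) = there (here refl)
... | no y≢b = trans (multiplicity-∉ verticalEdges {x′ , y} (column x (suc b) h) (∉-vertical (inj₁ y≢b)))
    (vertical-inside x x′ (suc b) h x′≡ (≤∧≢⇒< b≤y (y≢b ∘ sym)) (subst (y <_) (+-suc b h) y<))

-- A neighbouring column with base `a` and height `p` hides the rows below `a + p`. The two
-- truncated subtractions cover a neighbour ending at or below row `b` and one hiding all `h` rows.
ones-outside : ∀ g a p b h → (∀ y → b ≤ y → y < b + h → y < a + p → g y ≡ 2) →
  (∀ y → b ≤ y → y < b + h → a + p ≤ y → g y ≡ 1) → ones g b h ≡ h ∸ (a + p ∸ b)
ones-outside g a p b zero    two one = sym (0∸n≡0 (a + p ∸ b))
ones-outside g a p b (suc h) two one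
  with ones-outside g a p (suc b) h
         (λ y b<y y< → two y (<⇒≤ b<y) (subst (y <_) (sym (+-suc b h)) y<))
         (λ y b<y y< → one y (<⇒≤ b<y) (subst (y <_) (sym (+-suc b h)) y<))
     | <-≤-connex b (a + p)
... | ih | inj₁ b<top rewrite two b ≤-refl (m<m+n b (s≤s z≤n)) b<top =
  trans ih (cong (suc h ∸_) (sym (+-∸-assoc 1 b<top)))
... | ih | inj₂ top≤b rewrite one b ≤-refl (m<m+n b (s≤s z≤n)) top≤b
  | m≤n⇒m∸n≡0 top≤b | m≤n⇒m∸n≡0 (m≤n⇒m≤1+n top≤b) = cong suc ih

-- The first summand counts the left edges of the first column that are not
-- covered by the preceding column, of height p.
verticalBoundary : ℕ → List ℕ → ℕ
verticalBoundary p []       = 0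
verticalBoundary p (h ∷ hs) =
  ((h ∸ pred p) + suc (pred h ∸ first hs)) + verticalBoundary h hs

multiplicity-first-column : ∀ i y hs →
  multiplicity verticalEdges (i , y) (cellsFrom i hs) ≡ multiplicity verticalEdges (i , y) (column i i (first hs))
multiplicity-first-column i y []       = refl
multiplicity-first-column i y (h ∷ hs) =
  trans (cong (multiplicity verticalEdges (i , y)) (cellsFrom-∷ i h hs))
    (trans (multiplicity-++ verticalEdges (column i i h) (cellsFrom (suc i) hs))
      (trans (cong (_ +_) (multiplicity-none verticalEdges
        (All-cellsFrom (suc i) hs λ _ _ i<x → ∉-vertical (inj₂ (<⇒≢ i<x , <⇒≢ (m<n⇒m<1+n i<x))))))
        (+-identityʳ _)))

-- The column of height `p` is no longer counted but must stay in `N`, since it shares edges with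
-- the first remaining column. Columns before it have no vertical edge at an abscissa above `i`.
marked-vertical : ∀ N i p hs → All (1 ≤_) hs →
  (∀ x y → i < x → N (x , y) ≡ multiplicity verticalEdges (x , y) (cellsFrom i (p ∷ hs))) →
  marked N verticalEdges (cellsFrom (suc i) hs) ≡ verticalBoundary p hs
marked-vertical N i p [] _ _ = refl
marked-vertical N i p (suc h ∷ hs) (_ ∷ pos) agree = begin
  marked N verticalEdges (cellsFrom s (suc h ∷ hs))
    ≡⟨ cong (marked N verticalEdges) (cellsFrom-∷ s (suc h) hs) ⟩
  marked N verticalEdges (column s s (suc h) ++ cellsFrom (suc s) hs)
    ≡⟨ marked-++ N verticalEdges (column s s (suc h)) (cellsFrom (suc s) hs) ⟩
  marked N verticalEdges (column s s (suc h)) + marked N verticalEdges (cellsFrom (suc s) hs)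
    ≡⟨ cong₂ _+_ (marked-vertical-column N s s (suc h)) (marked-vertical N s (suc h) hs pos agree′) ⟩
  (ones left s (suc h) + ones right s (suc h)) + verticalBoundary (suc h) hs
    ≡⟨ cong (_+ verticalBoundary (suc h) hs) (cong₂ _+_ ones-left ones-right) ⟩
  verticalBoundary p (suc h ∷ hs) ∎
  where
  open ≡-Reasoning
  s = suc i
  left right : ℕ → ℕ
  left  y = N (s , y)
  right y = N (suc s , y)
  V = multiplicity verticalEdges
  split : ∀ x y → i < x → N (x , y) ≡ V (x , y) (column i i p) + V (x , y) (cellsFrom s (suc h ∷ hs))
  split x y i<x = trans (agree x y i<x)
    (trans (cong (V (x , y)) (cellsFrom-∷ i p (suc h ∷ hs)))
           (multiplicity-++ verticalEdges (column i i p) (cellsFrom s (suc h ∷ hs))))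
  agree′ : ∀ x y → s < x → N (x , y) ≡ V (x , y) (cellsFrom s (suc h ∷ hs))
  agree′ x y s<x = trans (split x y (<⇒≤ s<x)) (cong (_+ V (x , y) (cellsFrom s (suc h ∷ hs))) (multiplicity-none verticalEdges
    (All-column i i p λ _ _ _ → ∉-vertical (inj₂ (>⇒≢ (<⇒≤ s<x) , >⇒≢ s<x)))))
  left-value : ∀ y → s ≤ y → y < s + suc h → left y ≡ V (s , y) (column i i p) + 1
  left-value y s≤y y< = trans (split s y ≤-refl) (cong (V (s , y) (column i i p) +_)
    (trans (multiplicity-first-column s y (suc h ∷ hs)) (vertical-inside s s s (suc h) (inj₁ refl) s≤y y<)))
  right-value : ∀ y → s ≤ y → y < s + suc h → right y ≡ suc (V (suc s , y) (column (suc s) (suc s) (first hs)))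
  right-value y s≤y y< = trans (agree′ (suc s) y ≤-refl)
    (trans (cong (V (suc s , y)) (cellsFrom-∷ s (suc h) hs))
      (trans (multiplicity-++ verticalEdges (column s s (suc h)) (cellsFrom (suc s) hs))
        (cong₂ _+_ (vertical-inside s (suc s) s (suc h) (inj₂ refl) s≤y y<)
                   (multiplicity-first-column (suc s) y hs))))
  -- The preceding column starts one row lower, so at most `pred p` of its rows hide left edges
  -- here.
  ones-left : ones left s (suc h) ≡ suc h ∸ pred p
  ones-left = trans
    (ones-outside left i p s (suc h)
      (λ y s≤y y< y<top → trans (left-value y s≤y y<)
        (cong (_+ 1) (vertical-inside i s i p (inj₂ refl) (<⇒≤ s≤y) y<top)))
      (λ y s≤y y< top≤y → trans (left-value y s≤y y<)
        (cong (_+ 1) (vertical-outside i s i p (inj₂ top≤y)))))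
    (cong (suc h ∸_) (trans (cong (i + p ∸_) (+-comm 1 i)) (trans (sym (∸-+-assoc (i + p) i 1))
      (trans (cong (_∸ 1) (m+n∸m≡n i p)) (∸1≡pred p)))))
    where
    ∸1≡pred : ∀ n → n ∸ 1 ≡ pred n
    ∸1≡pred zero    = refl
    ∸1≡pred (suc n) = refl
  -- The next column starts one row higher, so the right edge of the bottom cell is always exposed;
  -- this is the outer `suc`.
  ones-right : ones right s (suc h) ≡ suc (h ∸ first hs)
  ones-right
    rewrite trans (right-value s ≤-refl (m<m+n s (s≤s z≤n)))
                  (cong suc (vertical-outside (suc s) (suc s) (suc s) (first hs) (inj₁ ≤-refl))) =
    cong suc (trans
      (ones-outside right (suc s) (first hs) (suc s) h
        (λ y s<y y< y<top → trans (right-value y (<⇒≤ s<y) (subst (y <_) (sym (+-suc s h)) y<))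
          (cong suc (vertical-inside (suc s) (suc s) (suc s) (first hs) (inj₁ refl) s<y y<top)))
        (λ y s<y y< top≤y → trans (right-value y (<⇒≤ s<y) (subst (y <_) (sym (+-suc s h)) y<))
          (cong suc (vertical-outside (suc s) (suc s) (suc s) (first hs) (inj₂ top≤y)))))
      (cong (h ∸_) (m+n∸m≡n (suc s) (first hs))))

-- The exposed left edges number `(h ∸ pred p) + rise (h ∷ hs)` and the exposed right edges
-- `h + rise (h ∷ hs)`.
verticalBoundary-ascent : ∀ p h hs → All (1 ≤_) (h ∷ hs) →
  verticalBoundary p (h ∷ hs) ≡ (h ∸ pred p) + h + 2 * rise (h ∷ hs)
verticalBoundary-ascent p zero    _  (() ∷ _)
verticalBoundary-ascent p (suc h) [] _ = refl
verticalBoundary-ascent p (suc h) (h′ ∷ hs) (_ ∷ pos) = begin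
  (a + suc (h ∸ h′)) + verticalBoundary (suc h) (h′ ∷ hs)
    ≡⟨ cong ((a + suc (h ∸ h′)) +_) (verticalBoundary-ascent (suc h) h′ hs pos) ⟩
  (a + suc (h ∸ h′)) + ((h′ ∸ h) + h′ + 2 * r)
    ≡⟨ lemma₁ a (h ∸ h′) (h′ ∸ h) h′ r ⟩
  a + suc (h′ + (h ∸ h′)) + ((h′ ∸ h) + 2 * r)
    -- Both `h′ + (h ∸ h′)` and `h + (h′ ∸ h)` are the maximum of `h` and `h′`; this exchanges
    -- exposed right edges for exposed left ones.
    ≡⟨ cong (λ z → a + suc z + ((h′ ∸ h) + 2 * r))
         (trans (+∸-⊔ h′ h) (trans (⊔-comm h h′) (sym (+∸-⊔ h h′)))) ⟩
  a + suc (h + (h′ ∸ h)) + ((h′ ∸ h) + 2 * r)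
    ≡⟨ lemma₂ a h (h′ ∸ h) r ⟩
  a + suc h + 2 * ((h′ ∸ h) + r) ∎
  where
  open ≡-Reasoning
  a = suc h ∸ pred p
  r = rise (h′ ∷ hs)
  lemma₁ : ∀ a b c d e → (a + suc b) + (c + d + 2 * e) ≡ a + suc (d + b) + (c + 2 * e)
  lemma₁ = solve-∀
  lemma₂ : ∀ a b c d → a + suc (b + c) + (c + 2 * d) ≡ a + suc b + 2 * (c + d)
  lemma₂ = solve-∀

horizontalBoundary-length : ∀ {hs} → All (1 ≤_) hs → length (boundary horizontalEdges (cells hs)) ≡ 2 * length hs
horizontalBoundary-length {hs} pos =
  marked-horizontal (λ e → multiplicity horizontalEdges e (cells hs)) 1 hs pos (λ _ _ _ → refl)

verticalBoundary-length : ∀ {hs} → All (1 ≤_) hs → length (boundary verticalEdges (cells hs)) ≡ 2 * ascent hs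
verticalBoundary-length {[]} _ = refl
verticalBoundary-length {h ∷ hs} pos = trans
  -- A phantom column of height 0 at abscissa 0 has no cells, so it turns the first column into one
  -- with a predecessor and leaves all its left edges exposed.
  (marked-vertical (λ e → multiplicity verticalEdges e (cells (h ∷ hs))) 0 0 (h ∷ hs) pos (λ _ _ _ → refl))
  (trans (verticalBoundary-ascent 0 h hs pos) (lemma h (rise (h ∷ hs))))
  where
  lemma : ∀ a b → a + a + 2 * b ≡ 2 * (a + b)
  lemma = solve-∀

-- Fibonacci polyominoes

IsFibonacci⇒positive : ∀ P → IsFibonacci P → All (1 ≤_) P
IsFibonacci⇒positive (h ∷ [])          1≤h        = 1≤h ∷ []
IsFibonacci⇒positive (h ∷ hs@(_ ∷ _)) (2≤h , fib) = <⇒≤ 2≤h ∷ IsFibonacci⇒positive hs fib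

𝓕⁺ : ∀ {m n P} → IsFibonacci P → length P ≡ m → ascent P ≡ n → 𝓕 m n P
𝓕⁺ {P = P} fib refl refl =
  fib , horizontalBoundary-length (IsFibonacci⇒positive P fib)
      , verticalBoundary-length (IsFibonacci⇒positive P fib)

𝓕⁻ : ∀ m n P → 𝓕 m n P → IsFibonacci P × length P ≡ m × ascent P ≡ n
𝓕⁻ m n P (fib , hor , ver) =
  fib , *-cancelˡ-≡ _ m 2 (trans (sym (horizontalBoundary-length (IsFibonacci⇒positive P fib))) hor)
      , *-cancelˡ-≡ _ n 2 (trans (sym (verticalBoundary-length (IsFibonacci⇒positive P fib))) ver)

-- On positive sequences the images are the polyominoes whose last column has height at least 2,
-- respectively exactly 1.
raise raise∷ʳ1 : List ℕ → List ℕ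
raise     Q = map suc Q
raise∷ʳ1 Q = map suc (Q ∷ʳ 0)

IsFibonacci-raise : ∀ h Q → All (1 ≤_) (h ∷ Q) → IsFibonacci (raise (h ∷ Q))
IsFibonacci-raise h []       _          = s≤s z≤n
IsFibonacci-raise h (h′ ∷ Q) (1≤h ∷ pos) = s≤s 1≤h , IsFibonacci-raise h′ Q pos

IsFibonacci-raise∷ʳ1 : ∀ {Q} → All (1 ≤_) Q → IsFibonacci (raise∷ʳ1 Q)
IsFibonacci-raise∷ʳ1 []                        = s≤s z≤n
IsFibonacci-raise∷ʳ1 (1≤h ∷ [])                = s≤s 1≤h , s≤s z≤n
IsFibonacci-raise∷ʳ1 (1≤h ∷ pos@(_ ∷ _))      = s≤s 1≤h , IsFibonacci-raise∷ʳ1 pos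

IsFibonacci⁻ : ∀ P → IsFibonacci P →
  Σ[ Q ∈ List ℕ ] (All (1 ≤_) Q × (raise Q ≡ P ⊎ raise∷ʳ1 Q ≡ P))
IsFibonacci⁻ (suc zero ∷ [])    _ = [] , [] , inj₂ refl
IsFibonacci⁻ (suc (suc h) ∷ []) _ = suc h ∷ [] , s≤s z≤n ∷ [] , inj₁ refl
IsFibonacci⁻ (suc h ∷ hs@(_ ∷ _)) (s≤s 1≤h , fib) with IsFibonacci⁻ hs fib
... | Q , pos , inj₁ eq = h ∷ Q , 1≤h ∷ pos , inj₁ (cong (suc h ∷_) eq)
... | Q , pos , inj₂ eq = h ∷ Q , 1≤h ∷ pos , inj₂ (cong (suc h ∷_) eq)

des-raise : ∀ Q → des (raise Q) ≡ des Q
des-raise []           = refl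
des-raise (h ∷ [])     = refl
des-raise (h ∷ h′ ∷ Q) = cong (_ +_) (des-raise (h′ ∷ Q))

lminBelow-raise : ∀ μ Q → lminBelow (suc μ) (raise Q) ≡ lminBelow μ Q
lminBelow-raise μ []      = refl
lminBelow-raise μ (h ∷ Q) = cong (_ +_) (lminBelow-raise (μ ⊓ h) Q)

lmin-raise : ∀ Q → lmin (raise Q) ≡ lmin Q
lmin-raise []      = refl
lmin-raise (h ∷ Q) = cong suc (lminBelow-raise h Q)

rise-raise : ∀ Q → rise (raise Q) ≡ rise Q
rise-raise []           = refl
rise-raise (h ∷ [])     = refl
rise-raise (h ∷ h′ ∷ Q) = cong ((suc h′ ∸ h) +_) (rise-raise (h′ ∷ Q))

-- The final 0 lies below every entry and adds a descent unless `Q` is empty, the exception built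
-- into `runs`.
des-∷ʳ0 : ∀ {Q} → All (1 ≤_) Q → des (Q ∷ʳ 0) ≡ runs Q
des-∷ʳ0 []                                       = refl
des-∷ʳ0 (1≤h ∷ [])                               = des-< [] 1≤h
des-∷ʳ0 {h ∷ h′ ∷ Q} (_ ∷ pos@(_ ∷ _)) =
  trans (cong (_ +_) (des-∷ʳ0 pos)) (+-suc _ (des (h′ ∷ Q)))

lminBelow-∷ʳ0 : ∀ {μ Q} → 1 ≤ μ → All (1 ≤_) Q → lminBelow μ (Q ∷ʳ 0) ≡ suc (lminBelow μ Q)
lminBelow-∷ʳ0 1≤μ [] = lminBelow-< [] 1≤μ
lminBelow-∷ʳ0 {μ} {h ∷ Q} 1≤μ (1≤h ∷ pos) =
  trans (cong (_ +_) (lminBelow-∷ʳ0 (⊓-glb 1≤μ 1≤h) pos)) (+-suc _ (lminBelow (μ ⊓ h) Q))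

lmin-∷ʳ0 : ∀ {Q} → All (1 ≤_) Q → lmin (Q ∷ʳ 0) ≡ suc (lmin Q)
lmin-∷ʳ0 []          = refl
lmin-∷ʳ0 (1≤h ∷ pos) = cong suc (lminBelow-∷ʳ0 1≤h pos)

-- The new term is `1 ∸ h` with `h` positive, so truncation makes it 0.
rise-∷ʳ0 : ∀ {Q} → All (1 ≤_) Q → rise (Q ∷ʳ 0) ≡ rise Q
rise-∷ʳ0 []                                   = refl
rise-∷ʳ0 (1≤h ∷ [])                           = trans (+-identityʳ _) (m≤n⇒m∸n≡0 1≤h)
rise-∷ʳ0 {h ∷ h′ ∷ Q} (_ ∷ pos@(_ ∷ _)) = cong ((suc h′ ∸ h) +_) (rise-∷ʳ0 pos)

length-raise∷ʳ1 : ∀ Q → length (raise∷ʳ1 Q) ≡ suc (length Q)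
length-raise∷ʳ1 Q = trans (length-map suc (Q ∷ʳ 0)) (trans (length-++ Q) (+-comm (length Q) 1))

ascent-raise : ∀ h Q → ascent (raise (h ∷ Q)) ≡ suc (ascent (h ∷ Q))
ascent-raise h Q = cong (suc h +_) (rise-raise (h ∷ Q))

ascent-raise∷ʳ1 : ∀ h Q → All (1 ≤_) (h ∷ Q) → ascent (raise∷ʳ1 (h ∷ Q)) ≡ suc (ascent (h ∷ Q))
ascent-raise∷ʳ1 h Q pos = cong (suc h +_) (trans (rise-raise (h ∷ Q ∷ʳ 0)) (rise-∷ʳ0 pos))

raise≢raise∷ʳ1 : ∀ {Q} → All (1 ≤_) Q → ∀ Q′ → raise Q ≢ raise∷ʳ1 Q′
raise≢raise∷ʳ1 pos Q′ eq with refl ← map-injective suc-injective eq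
  with () ∷ _ ← All.++⁻ʳ Q′ pos

theorem4p1 : ∀ (m n d j : ℕ) → 2 ≤ m → 2 ≤ n → 1 ≤ j →
    HasCardinality (λ P → 𝓕 m n P × des P ≡ d × lmin P ≡ j)
    (R m (d + 1) j * ((n ∸ 2) C (m ∸ 1)) + R (m ∸ 1) d (j ∸ 1) * ((n ∸ 2) C (m ∸ 2)))
theorem4p1 (suc (suc m)) (suc (suc n)) d (suc j) (s≤s (s≤s z≤n)) (s≤s (s≤s z≤n)) (s≤s z≤n) =
  card-bijection [ raise , raise∷ʳ1 ] pres inj surj
    -- Raising increases `ascent` by 1, through the first column alone, so both families have
    -- semiperimeter `suc n` before raising. In the second, the appended 0 supplies one column, one
    -- descent and one minimum, which leaves `suc m` columns, `d` runs and `j` minima.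
    (card-⊎ (card-PositiveSequence (suc m) n (d + 1) (suc j)) (card-PositiveSequence m n d j))
  where
  Source : List ℕ ⊎ List ℕ → Set
  Source = [ PositiveSequence (suc (suc m)) (suc n) (d + 1) (suc j) , PositiveSequence (suc m) (suc n) d j ]
  Target : List ℕ → Set
  Target P = 𝓕 (suc (suc m)) (suc (suc n)) P × des P ≡ d × lmin P ≡ suc j
  pres : ∀ y → Source y → Target ([ raise , raise∷ʳ1 ] y)
  pres (inj₁ Q@(h ∷ hs)) (pos , len , asc , run , lm) =
    𝓕⁺ (IsFibonacci-raise h hs pos) (trans (length-map suc Q) len) (trans (ascent-raise h hs) (cong suc asc))
    , trans (des-raise Q) (suc-injective (trans run (+-comm d 1)))
    , trans (lmin-raise Q) lm
  pres (inj₂ Q@(h ∷ hs)) (pos , len , asc , run , lm) =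
    𝓕⁺ (IsFibonacci-raise∷ʳ1 pos) (trans (length-raise∷ʳ1 Q) (cong suc len))
      (trans (ascent-raise∷ʳ1 h hs pos) (cong suc asc))
    , trans (des-raise (Q ∷ʳ 0)) (trans (des-∷ʳ0 pos) run)
    , trans (lmin-raise (Q ∷ʳ 0)) (trans (lmin-∷ʳ0 pos) (cong suc lm))
  inj : ∀ y y′ → Source y → Source y′ → [ raise , raise∷ʳ1 ] y ≡ [ raise , raise∷ʳ1 ] y′ → y ≡ y′
  inj (inj₁ Q) (inj₁ Q′) _ _ eq = cong inj₁ (map-injective suc-injective eq)
  inj (inj₁ Q) (inj₂ Q′) s _ eq = contradiction eq (raise≢raise∷ʳ1 (proj₁ s) Q′)
  inj (inj₂ Q) (inj₁ Q′) _ s eq = contradiction (sym eq) (raise≢raise∷ʳ1 (proj₁ s) Q)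
  inj (inj₂ Q) (inj₂ Q′) _ _ eq = cong inj₂ (∷ʳ-injectiveˡ Q Q′ (map-injective suc-injective eq))
  surj : ∀ P → Target P → Σ[ y ∈ List ℕ ⊎ List ℕ ] (Source y × [ raise , raise∷ʳ1 ] y ≡ P)
  surj P (𝓕P , ds , lm) with 𝓕⁻ (suc (suc m)) (suc (suc n)) P 𝓕P
  ... | fib , len , asc with IsFibonacci⁻ P fib
  ... | Q@(h ∷ hs) , pos , inj₁ refl =
    inj₁ Q
    , ( pos , trans (sym (length-map suc Q)) len
      , suc-injective (trans (sym (ascent-raise h hs)) asc)
      , trans (cong suc (trans (sym (des-raise Q)) ds)) (+-comm 1 d)
      , trans (sym (lmin-raise Q)) lm)
    , refl
  ... | Q@(h ∷ hs) , pos , inj₂ refl =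
    inj₂ Q
    , ( pos , suc-injective (trans (sym (length-raise∷ʳ1 Q)) len)
      , suc-injective (trans (sym (ascent-raise∷ʳ1 h hs pos)) asc)
      , trans (sym (trans (des-raise (Q ∷ʳ 0)) (des-∷ʳ0 pos))) ds
      , suc-injective (trans (sym (trans (lmin-raise (Q ∷ʳ 0)) (lmin-∷ʳ0 pos))) lm))
    , refl
  -- An empty `Q` yields at most one column, while `P` has at least two.
  surj _ (_ , _ , _) | _ , () , _ | [] , _ , inj₁ refl
  surj _ (_ , _ , _) | _ , () , _ | [] , _ , inj₂ refl
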